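{- Let $P$ be a finite $\Gamma$-colored poset. Then $P$ is a $\Gamma$-colored $d$-complete poset if and only if it is a dominant minuscule heap.
   Context: Setup. $\Gamma$ is a finite set, whose elements are called colors, with fixed integers $\theta_{ab}$ ($a,b\in\Gamma$) such that $\theta_{aa}=2$; $\theta_{ab}\le 0$ for $a\ne b$; and $\theta_{ab}=0$ iff $\theta_{ba}=0$. Such data is a Dynkin diagram; it is also viewed as a graph with an edge between distinct $a,b$ exactly when $\theta_{ab}<0$, and it is acyclic if this simple graph is acyclic. Distinct $a,b$ are distant if $\theta_{ab}=0$ and adjacent ($a\sim b$) if $\theta_{ab}<0$; $a$ is $k$-adjacent to $b$ if $\theta_{ab}=-k$. $x\to y$ means $x$ is covered by $y$; $x,y$ are neighbors if $x\to y$ or $y\to x$. A $\Gamma$-colored poset is a locally finite poset $P$ with a surjective map $\kappa:P\to\Gamma$; $P_a:=\kappa^{ -1}(a)$. Elements $x<y$ are consecutive elements of the color $a$ if $x,y\in P_a$ and the open interval $(x,y)$ contains no element of color $a$. $U(x,P):=\{y\in P : y>x,\ \kappa(y)\sim\kappa(x)\}$. A $\Gamma$-colored poset is $\Gamma$-colored $d$-complete if: (EC) elements with equal colors are comparable; (NA) neighbors have adjacent colors; (AC) elements with adjacent colors are comparable; (ICE2) for every $a\in\Gamma$, if $x<y$ are consecutive elements of the color $a$, then $\sum_{z\in(x,y)}-\theta_{\kappa(z),a}=2$; (UCB1) for every $a\in\Gamma$, if $x$ is maximal in $P_a$, then $U(x,P)$ is finite and $\sum_{y\in U(x,P)}-\theta_{\kappa(y),a}\le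 1$. A dominant minuscule heap is a finite $\Gamma$-colored poset such that: (S1) all neighbors have colors that are equal or adjacent, and the colors of incomparable elements are distant; (S2) for every $a\in\Gamma$, the open interval between any two consecutive elements of color $a$ contains either (i) exactly two elements whose colors are adjacent to $a$, and their colors are 1-adjacent to $a$, or (ii) exactly one element, and its color is 2-adjacent to $a$; (S3) for every $a\in\Gamma$, an element that is maximal in $P_a$ is covered by at most one element, and this element is maximal among all elements of some color that is 1-adjacent to $a$; (S4) $\Gamma$ is acyclic. -}

module Defs where

open import Data.Fin.Base using (Fin; zero; suc; inject₁; fromℕ)
open import Data.Integer.Base using (ℤ; +_; -_; 0ℤ)
  renaming (_+_ to _+ℤ_; _≤_ to _≤ℤ_; _<_ to _<ℤ_)
open import Data.List.Base using (List; []; _∷_; foldr; map; filter)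
open import Data.List.Membership.Propositional using (_∈_)
open import Data.List.Membership.Propositional.Properties
  using (∈-filter⁺; ∈-filter⁻)
open import Data.List.Relation.Unary.Any using (here)
open import Data.List.Relation.Unary.Any.Properties using (¬Any[])
open import Data.List.Relation.Unary.Unique.Propositional using (Unique)
open import Data.List.Relation.Unary.Unique.Propositional.Properties
  using (filter⁺)
open import Data.Nat.Base using (ℕ) renaming (_+_ to _+ℕ_)
open import Data.Product using (Σ; ∃; ∃₂; _×_; _,_; proj₁; proj₂)
open import Data.Sum using (_⊎_)
open import Function.Bundles using (_⇔_; mk⇔; Equivalence)
open import Function.Definitions using (Injective; Surjective)
open import Level using (Level; 0ℓ; _⊔_) renaming (suc to lsuc)
open import Relation.Binary.Core using (Rel)
open import Relation.Binary.Definitions using (Decidable)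
import Relation.Binary.Construct.NonStrictToStrict as ToStrict
open import Relation.Binary.PropositionalEquality
  using (_≡_; _≢_; refl)
open import Relation.Binary.Structures using (IsPartialOrder)
open import Relation.Nullary using (¬_; Dec; yes; no)
open import Relation.Nullary.Decidable using (_×-dec_)
open import Relation.Unary using (Pred)
  renaming (U to Everything; Decidable to Decidable₁; _⊆_ to _⊆₁_)

-- A subset is finite when it is listed without repetition; the sum of a
-- function over it is independent of the listing.

record Finite {a q} {A : Set a} (Q : Pred A q) : Set (a ⊔ q) where
  field
    elements   : List A
    unique     : Unique elements
    enumerates : ∀ x → x ∈ elements ⇔ Q x

FiniteType : ∀ {a} → Set a → Set a
FiniteType A = Finite {A = A} Everything

sumOver : ∀ {a q} {A : Set a} {Q : Pred A q} → Finite Q → (A → ℤ) → ℤ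
sumOver F f = foldr _+ℤ_ 0ℤ (map f (Finite.elements F))

finite-⊆ : ∀ {a q r} {A : Set a} {Q : Pred A q} {R : Pred A r} →
           Decidable₁ R → R ⊆₁ Q → Finite Q → Finite R
finite-⊆ R? R⊆Q F = record
  { elements   = filter R? elements
  ; unique     = filter⁺ R? unique
  ; enumerates = λ x → mk⇔
      (λ x∈ → proj₂ (∈-filter⁻ R? {xs = elements} x∈))
      (λ r → ∈-filter⁺ R? (Equivalence.from (enumerates x) (R⊆Q r)) r)
  }
  where open Finite F

record DynkinDiagram (g : Level) : Set (lsuc g) where
  field
    Color        : Set g
    color-finite : FiniteType Color
    θ            : Color → Color → ℤ
    θ-diag       : ∀ a → θ a a ≡ + 2
    θ-off-diag   : ∀ a b → a ≢ b → θ a b ≤ℤ 0ℤ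
    θ-zero       : ∀ a b → θ a b ≡ 0ℤ ⇔ θ b a ≡ 0ℤ

  infix 4 _∼_

  Distant : Rel Color g
  Distant a b = a ≢ b × θ a b ≡ 0ℤ

  _∼_ : Rel Color g
  a ∼ b = a ≢ b × θ a b <ℤ 0ℤ

  -- a is k-adjacent to b, which for k > 0 forces a ≢ b; not symmetric.
  Adjacent[_] : ℕ → Rel Color 0ℓ
  Adjacent[ k ] a b = θ a b ≡ - (+ k)

  record Cycle : Set g where
    field
      {n}      : ℕ
      vertex   : Fin (3 +ℕ n) → Color
      distinct : Injective _≡_ _≡_ vertex
      edge     : ∀ (i : Fin (2 +ℕ n)) → vertex (inject₁ i) ∼ vertex (suc i)
      closing  : vertex (fromℕ (2 +ℕ n)) ∼ vertex zero

  Acyclic : Set g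
  Acyclic = ¬ Cycle

record ColoredPoset {g} (Γ : DynkinDiagram g) (p ℓ : Level)
  : Set (g ⊔ lsuc (p ⊔ ℓ)) where
  open DynkinDiagram Γ
  infix 4 _≤_ _≤?_ _≟_ _<?_ _⋖_

  field
    Carrier        : Set p
    _≤_            : Rel Carrier ℓ
    isPartialOrder : IsPartialOrder _≡_ _≤_

  ClosedInterval : Carrier → Carrier → Pred Carrier ℓ
  ClosedInterval x y z = x ≤ z × z ≤ y

  -- The closed interval is empty when x ≰ y, so listing all the closed
  -- intervals also decides the order; no separate decidability is assumed.
  field
    locallyFinite : ∀ x y → Finite (ClosedInterval x y)
    κ             : Carrier → Color
    κ-surjective  : Surjective _≡_ _≡_ κ

  open ToStrict _≡_ _≤_ public using (_<_)
  private module PO = IsPartialOrder isPartialOrder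

  OpenInterval : Carrier → Carrier → Pred Carrier (p ⊔ ℓ)
  OpenInterval x y z = x < z × z < y

  _≤?_ : Decidable _≤_
  x ≤? y = decide (elements F) (enumerates F)
    where
    open Finite
    F = locallyFinite x y
    decide : (zs : List Carrier) →
             (∀ z → z ∈ zs ⇔ ClosedInterval x y z) → Dec (x ≤ y)
    decide []      e = no λ x≤y →
      ¬Any[] (Equivalence.from (e x) (PO.refl , x≤y))
    decide (z ∷ _) e with Equivalence.to (e z) (here refl)
    ... | x≤z , z≤y = yes (PO.trans x≤z z≤y)

  _≟_ : Decidable {A = Carrier} _≡_
  x ≟ y with x ≤? y | y ≤? x
  ... | yes x≤y | yes y≤x = yes (PO.antisym x≤y y≤x)
  ... | no  x≰y | _       = no λ { refl → x≰y PO.refl }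
  ... | _       | no y≰x  = no λ { refl → y≰x PO.refl }

  _<?_ : Decidable _<_
  _<?_ = ToStrict.<-decidable _≡_ _≤_ _≟_ _≤?_

  openInterval-finite : ∀ x y → Finite (OpenInterval x y)
  openInterval-finite x y =
    finite-⊆ (λ z → (x <? z) ×-dec (z <? y))
             (λ (x<z , z<y) → proj₁ x<z , proj₁ z<y)
             (locallyFinite x y)

  _⋖_ : Rel Carrier (p ⊔ ℓ)
  x ⋖ y = x < y × ¬ ∃ (OpenInterval x y)

  Neighbors : Rel Carrier (p ⊔ ℓ)
  Neighbors x y = x ⋖ y ⊎ y ⋖ x

  Comparable : Rel Carrier ℓ
  Comparable x y = x ≤ y ⊎ y ≤ x

  Consecutive : Color → Rel Carrier (g ⊔ p ⊔ ℓ)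
  Consecutive a x y =
    x < y × κ x ≡ a × κ y ≡ a × (∀ z → OpenInterval x y z → κ z ≢ a)

  MaximalOfColor : Color → Pred Carrier (g ⊔ p ⊔ ℓ)
  MaximalOfColor a x = κ x ≡ a × (∀ y → κ y ≡ a → ¬ x < y)

  U : Carrier → Pred Carrier (g ⊔ p ⊔ ℓ)
  U x y = x < y × κ y ∼ κ x

module _ {g p ℓ} {Γ : DynkinDiagram g} (P : ColoredPoset Γ p ℓ) where
  open DynkinDiagram Γ
  open ColoredPoset P

  FinitePoset : Set p
  FinitePoset = FiniteType Carrier

  record IsDComplete : Set (g ⊔ p ⊔ ℓ) where
    field
      EC   : ∀ x y → κ x ≡ κ y → Comparable x y
      NA   : ∀ x y → Neighbors x y → κ x ∼ κ y
      AC   : ∀ x y → κ x ∼ κ y → Comparable x y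
      ICE2 : ∀ a x y → Consecutive a x y →
             sumOver (openInterval-finite x y) (λ z → - θ (κ z) a) ≡ + 2
      UCB1 : ∀ a x → MaximalOfColor a x →
             Σ (Finite (U x)) λ U-finite →
               sumOver U-finite (λ y → - θ (κ y) a) ≤ℤ + 1

  record IsDominantMinusculeHeap : Set (g ⊔ p ⊔ ℓ) where
    field
      finite          : FinitePoset
      S1-neighbors    : ∀ x y → Neighbors x y → κ x ≡ κ y ⊎ κ x ∼ κ y
      S1-incomparable : ∀ x y → ¬ Comparable x y → Distant (κ x) (κ y)
      S2 : ∀ a x y → Consecutive a x y →
           (∃₂ λ u v → u ≢ v
              × (∀ z → (OpenInterval x y z × κ z ∼ a) ⇔ (z ≡ u ⊎ z ≡ v))
              × Adjacent[ 1 ] (κ u) a × Adjacent[ 1 ] (κ v) a)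
         ⊎ (∃ λ u → (∀ z → OpenInterval x y z ⇔ z ≡ u)
              × Adjacent[ 2 ] (κ u) a)
      S3 : ∀ a x → MaximalOfColor a x →
           (∀ y z → x ⋖ y → x ⋖ z → y ≡ z)
         × (∀ y → x ⋖ y → ∃ λ b → Adjacent[ 1 ] b a × MaximalOfColor b y)
      S4 : Acyclic

{-# OPTIONS --safe #-}

-- (⇒) Orient each edge of Γ by comparing the top elements of its two colours.
-- On a cycle of Γ, a minimal one among these top elements lies below the top
-- elements of two further adjacent colours, which UCB1 forbids.
--
-- (⇐) By S3 every cover of a top element is itself a top element, so the top
-- element x is joined to any z ∈ U(x) by a saturated chain whose colours are
-- pairwise distinct and consecutively adjacent.  As κ z ∼ κ x, a chain of
-- length at least two would close up to a cycle of Γ; hence z is the unique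
-- cover of x, which is UCB1.

module Submission where

open import Defs
open import Data.Empty using (⊥-elim)
open import Data.Fin.Base using (Fin; zero; suc; inject₁; fromℕ; toℕ)
open import Data.Fin.Induction using (spo-noetherian)
open import Data.Fin.Properties using (inj⇒≟; toℕ-inject₁)
open import Data.Fin.Relation.Unary.Top using (view; ‵fromℕ; ‵inject₁)
open import Data.Integer.Base using (ℤ; -_; 0ℤ; ∣_∣; +≤+; -≤+)
  renaming (+_ to pos; _+_ to _+ℤ_; _≤_ to _≤ℤ_; _<_ to _<ℤ_)
import Data.Integer.Properties as ℤ
open import Data.List.Base using (List; []; _∷_; map; foldr; lookup; allFin)
open import Data.List.Membership.Propositional using (_∈_)
open import Data.List.Membership.Propositional.Properties using (∈-allFin)
import Data.List.Membership.Setoid.Properties as Membershipₛ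
open import Data.List.Relation.Unary.All using (_∷_)
open import Data.List.Relation.Unary.All.Properties using (All¬⇒¬Any)
open import Data.List.Relation.Unary.AllPairs using (_∷_)
open import Data.List.Relation.Unary.Any using (here; there; index)
open import Data.List.Relation.Unary.Any.Properties using (lookup-index)
open import Data.List.Relation.Unary.Unique.Propositional using (Unique)
open import Data.List.Relation.Unary.Unique.Propositional.Properties
  using (allFin⁺)
open import Data.Nat.Base using (ℕ; zero; suc; _+_; _≤_; z≤n; s≤s)
open import Data.Nat.ListAction using (sum)
import Data.Nat.Properties as ℕ
open import Data.Product using (∃; ∃₂; _×_; _,_; proj₁; proj₂)
open import Data.Sum as Sum using (_⊎_; inj₁; inj₂; [_,_]′)
open import Data.Unit.Base using (tt)
open import Data.Vec.Functional as V using ()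
open import Function.Base using (_∘_; flip)
open import Function.Bundles using (_⇔_; mk⇔; mk↣; Equivalence)
open import Function.Definitions using (Injective)
open import Induction.WellFounded using (WellFounded; Acc; acc; module Subrelation)
open import Level using (_⊔_)
import Relation.Binary.Construct.Flip.EqAndOrd as Flip
import Relation.Binary.Construct.NonStrictToStrict as ToStrict
import Relation.Binary.Construct.On as On
open import Relation.Binary.Core using (Rel)
open import Relation.Binary.Definitions using (Decidable; DecidableEquality)
open import Relation.Binary.PropositionalEquality
  using (_≡_; _≢_; refl; sym; trans; cong; cong₂; subst; subst₂; setoid; module ≡-Reasoning)
open import Relation.Binary.Structures using (IsPartialOrder; IsStrictPartialOrder)
open import Relation.Nullary using (¬_; yes; no; contradiction)
open import Relation.Nullary.Decidable using (_×-dec_; map′)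
open import Relation.Unary using (Pred)

open Equivalence using (to; from)

-- Sums of natural numbers over lists.

module _ {a} {A : Set a} (f : A → ℕ) where

  Σf : List A → ℕ
  Σf = sum ∘ map f

  member-≤-sum : ∀ {xs u} → u ∈ xs → f u ≤ Σf xs
  member-≤-sum (here refl)        = ℕ.m≤m+n _ _
  member-≤-sum (there {x = x} u∈) = ℕ.m≤n⇒m≤o+n (f x) (member-≤-sum u∈)

  pair-≤-sum : ∀ {xs u v} → u ≢ v → u ∈ xs → v ∈ xs → f u + f v ≤ Σf xs
  pair-≤-sum u≢v (here refl) (here refl) = contradiction refl u≢v
  pair-≤-sum {u = u} u≢v (here refl) (there v∈) =
    ℕ.+-monoʳ-≤ (f u) (member-≤-sum v∈)
  pair-≤-sum {u = u} {v} u≢v (there u∈) (here refl) =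
    ℕ.≤-trans (ℕ.≤-reflexive (ℕ.+-comm (f u) (f v))) (ℕ.+-monoʳ-≤ (f v) (member-≤-sum u∈))
  pair-≤-sum u≢v (there {x = x} u∈) (there v∈) =
    ℕ.m≤n⇒m≤o+n (f x) (pair-≤-sum u≢v u∈ v∈)

  sum-zero : ∀ xs → (∀ {z} → z ∈ xs → f z ≡ 0) → Σf xs ≡ 0
  sum-zero []       f≡0 = refl
  sum-zero (x ∷ xs) f≡0 = cong₂ _+_ (f≡0 (here refl)) (sum-zero xs (f≡0 ∘ there))

  sum-singleton : ∀ {xs u} → Unique xs → u ∈ xs →
                  (∀ {z} → z ∈ xs → z ≢ u → f z ≡ 0) → Σf xs ≡ f u
  sum-singleton {x ∷ xs} (x∉ ∷ _) (here refl) f≡0 =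
    trans (cong (f x +_) (sum-zero xs λ z∈ → f≡0 (there z∈) λ { refl → All¬⇒¬Any x∉ z∈ }))
          (ℕ.+-identityʳ (f x))
  sum-singleton (x∉ ∷ !xs) (there u∈) f≡0 =
    cong₂ _+_ (f≡0 (here refl) λ { refl → All¬⇒¬Any x∉ u∈ })
              (sum-singleton !xs u∈ (f≡0 ∘ there))

  sum-pair : ∀ {xs u v} → Unique xs → u ≢ v → u ∈ xs → v ∈ xs →
             (∀ {z} → z ∈ xs → z ≢ u → z ≢ v → f z ≡ 0) → Σf xs ≡ f u + f v
  sum-pair _ u≢v (here refl) (here refl) _ = contradiction refl u≢v
  sum-pair {u = u} (u∉ ∷ !xs) u≢v (here refl) (there v∈) f≡0 =
    cong (f u +_) (sum-singleton !xs v∈ λ z∈ →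
      f≡0 (there z∈) λ { refl → All¬⇒¬Any u∉ z∈ })
  sum-pair {u = u} {v} (v∉ ∷ !xs) u≢v (there u∈) (here refl) f≡0 =
    trans (cong (f v +_) (sum-singleton !xs u∈ λ z∈ z≢u →
            f≡0 (there z∈) z≢u λ { refl → All¬⇒¬Any v∉ z∈ }))
          (ℕ.+-comm (f v) (f u))
  sum-pair (x∉ ∷ !xs) u≢v (there u∈) (there v∈) f≡0 =
    cong₂ _+_ (f≡0 (here refl) (λ { refl → All¬⇒¬Any x∉ u∈ })
                               (λ { refl → All¬⇒¬Any x∉ v∈ }))
              (sum-pair !xs u≢v u∈ v∈ (f≡0 ∘ there))

  sum≡0⇒all≡0 : ∀ {xs z} → Σf xs ≡ 0 → z ∈ xs → f z ≡ 0
  sum≡0⇒all≡0 eq z∈ = ℕ.n≤0⇒n≡0 (subst (_ ≤_) eq (member-≤-sum z∈))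

  sum≡1⇒singleton : ∀ xs → Σf xs ≡ 1 →
    ∃ λ u → u ∈ xs × f u ≡ 1 × (∀ {z} → z ∈ xs → f z ≢ 0 → z ≡ u)
  sum≡1⇒singleton (x ∷ xs) eq with f x in fx
  ... | 0 with sum≡1⇒singleton xs eq
  ...   | u , u∈ , fu , only = u , there u∈ , fu , λ where
            (here refl) fz≢0 → contradiction fx fz≢0
            (there z∈)  fz≢0 → only z∈ fz≢0
  sum≡1⇒singleton (x ∷ xs) eq | 1 = x , here refl , fx , λ where
    (here refl) _    → refl
    (there z∈)  fz≢0 → contradiction (sum≡0⇒all≡0 (ℕ.suc-injective eq) z∈) fz≢0

  -- A total of 2 arises from zeros together with either two ones or a single 2. These cases become
  -- the two alternatives of S2. Uniqueness of the list keeps the two ones at different elements.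
  sum≡2⇒pair⊎singleton : ∀ {xs} → Unique xs → Σf xs ≡ 2 →
      (∃₂ λ u v → u ≢ v × u ∈ xs × v ∈ xs × f u ≡ 1 × f v ≡ 1 ×
                  (∀ {z} → z ∈ xs → f z ≢ 0 → z ≡ u ⊎ z ≡ v))
    ⊎ (∃ λ u → u ∈ xs × f u ≡ 2 × (∀ {z} → z ∈ xs → f z ≢ 0 → z ≡ u))
  sum≡2⇒pair⊎singleton {x ∷ xs} (x∉ ∷ !xs) eq with f x in fx
  ... | 0 with sum≡2⇒pair⊎singleton !xs eq
  ...   | inj₁ (u , v , u≢v , u∈ , v∈ , fu , fv , only) =
            inj₁ (u , v , u≢v , there u∈ , there v∈ , fu , fv , λ where
              (here refl) fz≢0 → contradiction fx fz≢0
              (there z∈)  fz≢0 → only z∈ fz≢0)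
  ...   | inj₂ (u , u∈ , fu , only) = inj₂ (u , there u∈ , fu , λ where
            (here refl) fz≢0 → contradiction fx fz≢0
            (there z∈)  fz≢0 → only z∈ fz≢0)
  sum≡2⇒pair⊎singleton {x ∷ xs} (x∉ ∷ !xs) eq | 1
    with sum≡1⇒singleton xs (ℕ.suc-injective eq)
  ... | v , v∈ , fv , only =
        inj₁ (x , v , (λ { refl → All¬⇒¬Any x∉ v∈ }) , here refl , there v∈ , fx , fv , λ where
          (here refl) _    → inj₁ refl
          (there z∈)  fz≢0 → inj₂ (only z∈ fz≢0))
  sum≡2⇒pair⊎singleton {x ∷ xs} (x∉ ∷ !xs) eq | 2 = inj₂ (x , here refl , fx , λ where
    (here refl) _    → refl
    (there z∈)  fz≢0 →
      contradiction (sum≡0⇒all≡0 (ℕ.suc-injective (ℕ.suc-injective eq)) z∈) fz≢0)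

-- From integer sums to natural-number sums.

i≤0⇒-i≡+∣i∣ : ∀ {i} → i ≤ℤ 0ℤ → - i ≡ pos ∣ i ∣
i≤0⇒-i≡+∣i∣ -≤+       = refl
i≤0⇒-i≡+∣i∣ (+≤+ z≤n) = refl

sumOver-neg : ∀ {a q} {A : Set a} {Q : Pred A q} (F : Finite Q) {h : A → ℤ} →
              (∀ z → Q z → h z ≤ℤ 0ℤ) →
              sumOver F (λ z → - h z) ≡ pos (Σf (∣_∣ ∘ h) (Finite.elements F))
sumOver-neg F {h} h≤0 = go elements λ {z} z∈ → h≤0 z (to (enumerates z) z∈)
  where
  open Finite F
  go : ∀ zs → (∀ {z} → z ∈ zs → h z ≤ℤ 0ℤ) →
       foldr _+ℤ_ 0ℤ (map (λ z → - h z) zs) ≡ pos (Σf (∣_∣ ∘ h) zs)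
  go []       _   = refl
  go (z ∷ zs) h≤0 =
    trans (cong₂ _+ℤ_ (i≤0⇒-i≡+∣i∣ (h≤0 (here refl))) (go zs (h≤0 ∘ there)))
          (sym (ℤ.pos-+ ∣ h z ∣ _))

-- Finite types: decidable equality, well-foundedness, minimal elements.

Fin-finite : ∀ n → FiniteType (Fin n)
Fin-finite n = record
  { elements   = allFin n
  ; unique     = allFin⁺ n
  ; enumerates = λ i → mk⇔ _ λ _ → ∈-allFin i
  }

module _ {a} {A : Set a} (A-finite : FiniteType A) where
  open Finite A-finite

  private
    position : ∀ x → x ∈ elements
    position x = from (enumerates x) tt

  finite⇒≡-dec : DecidableEquality A
  finite⇒≡-dec = inj⇒≟ (mk↣ {to = index ∘ position} λ {x} {y} →
    Membershipₛ.index-injective (setoid A) (position x) (position y))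

  -- The listing sends each element to its position. The order pulled back to positions is a strict
  -- partial order on some `Fin n`, hence noetherian, and this is carried back to `A`.
  finite⇒noetherian : ∀ {r} {_⊏_ : Rel A r} → IsStrictPartialOrder _≡_ _⊏_ →
                      WellFounded (flip _⊏_)
  finite⇒noetherian {_⊏_ = _⊏_} spo =
    Subrelation.wellFounded
      (λ {x} {y} → subst₂ (flip _⊏_) (lookup-index (position x)) (lookup-index (position y)))
      (On.wellFounded (index ∘ position)
        (spo-noetherian (On.isStrictPartialOrder (lookup elements) spo)))

module _ {a e r} {A : Set a} {_≈_ : Rel A e} {_⊏_ : Rel A r}
         (spo : IsStrictPartialOrder _≈_ _⊏_) (_⊏?_ : Decidable _⊏_) where
  private
    module SPO = IsStrictPartialOrder spo

    minimal-∈ : ∀ x xs → ∃ λ m → m ∈ x ∷ xs × (∀ {w} → w ∈ x ∷ xs → ¬ w ⊏ m)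
    minimal-∈ x []       = x , here refl , λ { (here refl) → SPO.irrefl SPO.Eq.refl }
    minimal-∈ x (y ∷ ys) with minimal-∈ y ys
    ... | m , m∈ , min with x ⊏? m
    ...   | yes x⊏m = x , here refl , λ where
              (here refl) → SPO.irrefl SPO.Eq.refl
              (there w∈) w⊏x → min w∈ (SPO.trans w⊏x x⊏m)
    ...   | no  x⊏̸m = m , there m∈ , λ where
              (here refl) → x⊏̸m
              (there w∈)  → min w∈

  -- The order and its equality are arbitrary, so that a flipped order yields maximal elements and
  -- an order pulled back along a family yields an index whose value is minimal.
  minimal : ∀ {q} {Q : Pred A q} → Finite Q → ∃ Q →
            ∃ λ m → Q m × (∀ w → Q w → ¬ w ⊏ m)
  minimal F (x , Qx) with Finite.elements F | Finite.enumerates F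
  ... | []     | enum = contradiction (from (enum x) Qx) λ ()
  ... | y ∷ ys | enum with minimal-∈ y ys
  ...   | m , m∈ , min = m , to (enum m) m∈ , λ w Qw → min (from (enum w) Qw)

-- Adjacency and cycles in a Dynkin diagram.

module _ {g} (Γ : DynkinDiagram g) where
  open DynkinDiagram Γ

  weight : Color → Color → ℕ
  weight b a = ∣ θ b a ∣

  -- The diagonal entries are 2, so a negative entry already separates the colours. Adjacency can
  -- thus be decided by a sign test.
  θ<0⇒∼ : ∀ {a b} → θ a b <ℤ 0ℤ → a ∼ b
  θ<0⇒∼ {a} θ<0 =
    (λ { refl → ℤ.<-asym θ<0 (subst (0ℤ <ℤ_) (sym (θ-diag a)) (ℤ.positive⁻¹ (pos 2))) }) , θ<0

  ≁⇒weight≡0 : ∀ {a b} → a ≢ b → ¬ a ∼ b → weight a b ≡ 0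
  ≁⇒weight≡0 {a} {b} a≢b a≁b =
    cong ∣_∣ (ℤ.≤-antisym (θ-off-diag a b a≢b) (ℤ.≮⇒≥ (a≁b ∘ (a≢b ,_))))

  weight≢0⇒∼ : ∀ {a b} → a ≢ b → weight a b ≢ 0 → a ∼ b
  weight≢0⇒∼ {a} {b} a≢b w≢0 =
    a≢b , ℤ.≤∧≢⇒< (θ-off-diag a b a≢b) (w≢0 ∘ cong ∣_∣)

  ∼⇒weight≢0 : ∀ {a b} → a ∼ b → weight a b ≢ 0
  ∼⇒weight≢0 (_ , θ<0) w≡0 = ℤ.<-irrefl (ℤ.∣i∣≡0⇒i≡0 w≡0) θ<0

  -- The entries `θ a b` and `θ b a` may differ, but `θ-zero` makes them vanish together, and off
  -- the diagonal nonzero means negative.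
  ∼-sym : ∀ {a b} → a ∼ b → b ∼ a
  ∼-sym {a} {b} (a≢b , θ<0) =
    a≢b ∘ sym ,
    ℤ.≤∧≢⇒< (θ-off-diag b a (a≢b ∘ sym)) λ θba≡0 → ℤ.<-irrefl (from (θ-zero a b) θba≡0) θ<0

  Adjacent⇒weight : ∀ {k a b} → Adjacent[ k ] a b → weight a b ≡ k
  Adjacent⇒weight {k} adj = trans (cong ∣_∣ adj) (ℤ.∣-i∣≡∣i∣ (pos k))

  weight⇒Adjacent : ∀ {k a b} → a ≢ b → weight a b ≡ k → Adjacent[ k ] a b
  weight⇒Adjacent {a = a} {b} a≢b refl =
    trans (sym (ℤ.neg-involutive (θ a b))) (cong -_ (i≤0⇒-i≡+∣i∣ (θ-off-diag a b a≢b)))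

  module _ (C : Cycle) where
    open Cycle C

    two-neighbours : ∀ i → ∃₂ λ j k →
      j ≢ k × vertex i ∼ vertex j × vertex i ∼ vertex k
    two-neighbours zero = suc zero , fromℕ _ , (λ ()) , edge zero , ∼-sym closing
    two-neighbours (suc i) with view i
    ... | ‵fromℕ     =
          inject₁ (fromℕ _) , zero , (λ ()) , ∼-sym (edge (fromℕ _)) , closing
    ... | ‵inject₁ j =
          inject₁ (inject₁ j) , suc (suc j) , apart , ∼-sym (edge (inject₁ j)) , edge (suc j)
      where
      -- The vertex in question has index j + 1; its neighbours have indices j and j + 2.
      apart : inject₁ (inject₁ j) ≢ suc (suc j)
      apart eq = ℕ.m≢1+n+m (toℕ j) {1} (trans
        (sym (trans (toℕ-inject₁ (inject₁ j)) (toℕ-inject₁ j))) (cong toℕ eq))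

-- Covers, tops of colours and weight sums in a coloured poset.

module _ {g p ℓ} {Γ : DynkinDiagram g} (P : ColoredPoset Γ p ℓ) where
  open DynkinDiagram Γ
  open ColoredPoset P renaming (_≤_ to _⊑_; _<_ to _⊏_; _<?_ to _⊏?_; _≤?_ to _⊑?_)
  private
    module PO = IsPartialOrder isPartialOrder

  ⊏-isStrictPartialOrder : IsStrictPartialOrder _≡_ _⊏_
  ⊏-isStrictPartialOrder = ToStrict.<-isStrictPartialOrder _≡_ _⊑_ isPartialOrder

  private
    module SPO = IsStrictPartialOrder ⊏-isStrictPartialOrder

  ⊏-⊑-trans : ∀ {x y z} → x ⊏ y → y ⊑ z → x ⊏ z
  ⊏-⊑-trans = ToStrict.<-≤-trans _≡_ _⊑_ sym PO.trans PO.antisym PO.≤-respʳ-≈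

  ⊑-⊏-trans : ∀ {x y z} → x ⊑ y → y ⊏ z → x ⊏ z
  ⊑-⊏-trans = ToStrict.≤-<-trans _≡_ _⊑_ PO.trans PO.antisym PO.≤-respˡ-≈

  -- The witness is a minimal element of the half-open interval from x (excluded) to z (included),
  -- which is finite by local finiteness and contains z.
  cover-above : ∀ {x z} → x ⊏ z → ∃ λ w → x ⋖ w × w ⊑ z
  cover-above {x} {z} x⊏z
    with minimal ⊏-isStrictPartialOrder _⊏?_
           (finite-⊆ (λ w → (x ⊏? w) ×-dec (w ⊑? z))
                     (λ (x⊏w , w⊑z) → proj₁ x⊏w , w⊑z) (locallyFinite x z))
           (z , x⊏z , PO.refl)
  ... | w , (x⊏w , w⊑z) , min =
        w , (x⊏w , λ (v , x⊏v , v⊏w) → min v (x⊏v , PO.trans (proj₁ v⊏w) w⊑z) v⊏w) , w⊑z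

  cover-below : ∀ {x z} → x ⊏ z → ∃ λ w → x ⊑ w × w ⋖ z
  cover-below {x} {z} x⊏z
    with minimal (Flip.isStrictPartialOrder ⊏-isStrictPartialOrder) (flip _⊏?_)
           (finite-⊆ (λ w → (x ⊑? w) ×-dec (w ⊏? z))
                     (λ (x⊑w , w⊏z) → x⊑w , proj₁ w⊏z) (locallyFinite x z))
           (x , PO.refl , x⊏z)
  ... | w , (x⊑w , w⊏z) , max =
        w , x⊑w , (w⊏z , λ (v , w⊏v , v⊏z) → max v (PO.trans x⊑w (proj₁ w⊏v) , v⊏z) w⊏v)

  minimal-index : ∀ {n} (t : Fin (suc n) → Carrier) → ∃ λ i → ∀ j → ¬ t j ⊏ t i
  minimal-index t
    with minimal (On.isStrictPartialOrder t ⊏-isStrictPartialOrder)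
                 (λ i j → t i ⊏? t j) (Fin-finite _) (zero , tt)
  ... | i , _ , min = i , λ j → min j tt

  comparable⇒⊏ : ∀ {x y} → Comparable x y → x ≢ y → ¬ y ⊏ x → x ⊏ y
  comparable⇒⊏ (inj₁ x⊑y) x≢y _   = x⊑y , x≢y
  comparable⇒⊏ (inj₂ y⊑x) x≢y y⊏̸x = contradiction (y⊑x , x≢y ∘ sym) y⊏̸x

  comparable? : Decidable Comparable
  comparable? x y with x ⊑? y | y ⊑? x
  ... | yes x⊑y | _       = yes (inj₁ x⊑y)
  ... | no  _   | yes y⊑x = yes (inj₂ y⊑x)
  ... | no  x⋢y | no  y⋢x = no [ x⋢y , y⋢x ]′

  interval-sum : ∀ {a x y} → Consecutive a x y →
    sumOver (openInterval-finite x y) (λ z → - θ (κ z) a) ≡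
    pos (Σf (λ z → weight Γ (κ z) a) (Finite.elements (openInterval-finite x y)))
  interval-sum {a} {x} {y} (_ , _ , _ , gap) =
    sumOver-neg (openInterval-finite x y) λ z z∈ → θ-off-diag (κ z) a (gap z z∈)

  U-sum : ∀ {x} (U-finite : Finite (U x)) →
    sumOver U-finite (λ y → - θ (κ y) (κ x)) ≡
    pos (Σf (λ y → weight Γ (κ y) (κ x)) (Finite.elements U-finite))
  U-sum U-finite = sumOver-neg U-finite λ z (_ , _ , θ<0) → ℤ.<⇒≤ θ<0

  module _ (P-finite : FinitePoset P) where

    -- The colour class is nonempty because `κ` is surjective, and finite because P is.
    top : ∀ a → ∃ (MaximalOfColor a)
    top a
      with minimal (Flip.isStrictPartialOrder ⊏-isStrictPartialOrder) (flip _⊏?_)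
             (finite-⊆ (λ x → finite⇒≡-dec color-finite (κ x) a) _ P-finite)
             (proj₁ (κ-surjective a) , proj₂ (κ-surjective a) refl)
    ... | x , κx≡a , max = x , κx≡a , max

    -- From d-complete to dominant minuscule heap.

    module _ (dc : IsDComplete P) where
      open IsDComplete dc

      U-weight-sum-≤1 : ∀ {x} (x-max : MaximalOfColor (κ x) x) →
        Σf (λ y → weight Γ (κ y) (κ x))
           (Finite.elements (proj₁ (UCB1 (κ x) x x-max))) ≤ 1
      U-weight-sum-≤1 {x} x-max with UCB1 (κ x) x x-max
      ... | U-finite , bound = ℤ.drop‿+≤+ (subst (_≤ℤ pos 1) (U-sum U-finite) bound)

      U-weight≡1 : ∀ {x y} → MaximalOfColor (κ x) x → U x y → weight Γ (κ y) (κ x) ≡ 1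
      U-weight≡1 {x} {y} x-max y∈U = ℕ.≤-antisym
        (ℕ.≤-trans (member-≤-sum _ (from (Finite.enumerates U-finite y) y∈U))
                   (U-weight-sum-≤1 x-max))
        (ℕ.n≢0⇒n>0 (∼⇒weight≢0 Γ (proj₂ y∈U)))
        where U-finite = proj₁ (UCB1 (κ x) x x-max)

      -- Two different elements would each contribute weight 1 to a sum that UCB1 bounds by 1.
      U-unique : ∀ {x y z} → MaximalOfColor (κ x) x → U x y → U x z → y ≡ z
      U-unique {x} {y} {z} x-max y∈U z∈U with y ≟ z
      ... | yes y≡z = y≡z
      ... | no  y≢z = contradiction
              (subst₂ (λ m n → m + n ≤ 1) (U-weight≡1 x-max y∈U) (U-weight≡1 x-max z∈U)
                (ℕ.≤-trans
                  (pair-≤-sum (λ y → weight Γ (κ y) (κ x)) y≢z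
                    (from (Finite.enumerates U-finite y) y∈U)
                    (from (Finite.enumerates U-finite z) z∈U))
                  (U-weight-sum-≤1 x-max)))
              λ { (s≤s ()) }
        where U-finite = proj₁ (UCB1 (κ x) x x-max)

      cover∈U : ∀ {x y} → x ⋖ y → U x y
      cover∈U {x} {y} x⋖y = proj₁ x⋖y , NA y x (inj₂ x⋖y)

      dcomplete⇒S1 : ∀ x y → ¬ Comparable x y → Distant (κ x) (κ y)
      dcomplete⇒S1 x y x∥y =
        κx≢κy , ℤ.∣i∣≡0⇒i≡0 (≁⇒weight≡0 Γ κx≢κy (x∥y ∘ AC x y))
        where
        κx≢κy : κ x ≢ κ y
        κx≢κy = x∥y ∘ EC x y

      -- Alternative (ii) of S2 restricts all elements of the interval, not just those of adjacent
      -- colour. Given z inside, take a cover v of x below z and an element w above z that y covers.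
      -- By NA both have colours adjacent to that of x and y, so both equal u, and z is squeezed
      -- between them.
      interval-singleton : ∀ {x y u} → Consecutive (κ x) x y → OpenInterval x y u →
        (∀ {z} → OpenInterval x y z → κ z ∼ κ x → z ≡ u) →
        ∀ z → OpenInterval x y z ⇔ z ≡ u
      interval-singleton {x} {y} {u} (_ , _ , κy≡κx , _) u∈ only z = mk⇔ ⇒ λ { refl → u∈ }
        where
        ⇒ : OpenInterval x y z → z ≡ u
        ⇒ (x⊏z , z⊏y) with cover-above x⊏z | cover-below z⊏y
        ... | v , x⋖v , v⊑z | w , z⊑w , w⋖y
          with only (proj₁ x⋖v , ⊑-⊏-trans v⊑z z⊏y) (NA v x (inj₂ x⋖v))
             | only (⊏-⊑-trans x⊏z z⊑w , proj₁ w⋖y)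
                    (subst (κ w ∼_) κy≡κx (NA w y (inj₁ w⋖y)))
        ... | refl | refl = PO.antisym z⊑w v⊑z

      dcomplete⇒S2 : ∀ a x y → Consecutive a x y →
          (∃₂ λ u v → u ≢ v
             × (∀ z → (OpenInterval x y z × κ z ∼ a) ⇔ (z ≡ u ⊎ z ≡ v))
             × Adjacent[ 1 ] (κ u) a × Adjacent[ 1 ] (κ v) a)
        ⊎ (∃ λ u → (∀ z → OpenInterval x y z ⇔ z ≡ u) × Adjacent[ 2 ] (κ u) a)
      dcomplete⇒S2 a x y cons@(_ , refl , _ , gap) =
        -- By ICE2 the weights in the interval add up to 2; elements of weight 0 are those of
        -- distant colour.
        Sum.map pair singleton (sum≡2⇒pair⊎singleton w unique
          (ℤ.+-injective (trans (sym (interval-sum cons)) (ICE2 a x y cons))))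
        where
        open Finite (openInterval-finite x y)

        w : Carrier → ℕ
        w z = weight Γ (κ z) a

        κ≢ : ∀ {z} → z ∈ elements → κ z ≢ a
        κ≢ {z} z∈ = gap z (to (enumerates z) z∈)

        member : ∀ {z} → z ∈ elements → w z ≡ 1 → OpenInterval x y z × κ z ∼ a
        member {z} z∈ wz = to (enumerates z) z∈ ,
          weight≢0⇒∼ Γ (κ≢ z∈) λ w≡0 → contradiction (trans (sym wz) w≡0) λ ()

        pair : (∃₂ λ u v → u ≢ v × u ∈ elements × v ∈ elements × w u ≡ 1 × w v ≡ 1 ×
                  (∀ {z} → z ∈ elements → w z ≢ 0 → z ≡ u ⊎ z ≡ v)) → _
        pair (u , v , u≢v , u∈ , v∈ , wu , wv , only) = u , v , u≢v
          , (λ z → mk⇔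
              (λ (z∈ , κz∼a) → only (from (enumerates z) z∈) (∼⇒weight≢0 Γ κz∼a))
              λ { (inj₁ refl) → member u∈ wu ; (inj₂ refl) → member v∈ wv })
          , weight⇒Adjacent Γ (κ≢ u∈) wu
          , weight⇒Adjacent Γ (κ≢ v∈) wv

        singleton : (∃ λ u → u ∈ elements × w u ≡ 2 ×
                       (∀ {z} → z ∈ elements → w z ≢ 0 → z ≡ u)) → _
        singleton (u , u∈ , wu , only) = u
          , interval-singleton cons (to (enumerates u) u∈)
              (λ {z} z∈ κz∼a → only (from (enumerates z) z∈) (∼⇒weight≢0 Γ κz∼a))
          , weight⇒Adjacent Γ (κ≢ u∈) wu

      dcomplete⇒S3 : ∀ a x → MaximalOfColor a x →
          (∀ y z → x ⋖ y → x ⋖ z → y ≡ z)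
        × (∀ y → x ⋖ y → ∃ λ b → Adjacent[ 1 ] b a × MaximalOfColor b y)
      dcomplete⇒S3 a x x-max@(refl , _) =
          (λ y z x⋖y x⋖z → U-unique x-max (cover∈U x⋖y) (cover∈U x⋖z))
        , λ y x⋖y → κ y
            , weight⇒Adjacent Γ (proj₁ (NA y x (inj₂ x⋖y))) (U-weight≡1 x-max (cover∈U x⋖y))
            , refl
            -- A larger element z of the colour of y would also lie in `U x`, next to y itself.
            , λ z κz≡κy y⊏z → proj₂ y⊏z (U-unique x-max (cover∈U x⋖y)
                ( SPO.trans (proj₁ x⋖y) y⊏z
                , subst (_∼ κ x) (sym κz≡κy) (NA y x (inj₂ x⋖y))))

      module _ (C : Cycle) where
        open Cycle C

        cycle-has-no-least-top : (t : Fin (3 + n) → Carrier) →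
          (∀ i → MaximalOfColor (vertex i) (t i)) → ∀ i → ¬ (∀ j → ¬ t j ⊏ t i)
        cycle-has-no-least-top t t-max i least with two-neighbours Γ C i
        ... | j , k , j≢k , i∼j , i∼k = j≢k (distinct (begin
            vertex j   ≡⟨ κt j ⟨
            κ (t j)    ≡⟨ cong κ (U-unique ti-max (t∈U i∼j) (t∈U i∼k)) ⟩
            κ (t k)    ≡⟨ κt k ⟩
            vertex k   ∎))
          where
          open ≡-Reasoning

          κt : ∀ i → κ (t i) ≡ vertex i
          κt i = proj₁ (t-max i)

          ti-max : MaximalOfColor (κ (t i)) (t i)
          ti-max = refl , λ y κy≡κti → proj₂ (t-max i) y (trans κy≡κti (κt i))

          -- AC makes the two tops comparable, their colours make them different, and minimality of
          -- `t i` leaves only one direction.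
          t∈U : ∀ {j} → vertex i ∼ vertex j → U (t i) (t j)
          t∈U {j} i∼j =
            comparable⇒⊏ (AC (t i) (t j) κi∼κj) (proj₁ κi∼κj ∘ cong κ) (least j) ,
            ∼-sym Γ κi∼κj
            where
            κi∼κj : κ (t i) ∼ κ (t j)
            κi∼κj = subst₂ _∼_ (sym (κt i)) (sym (κt j)) i∼j

      dcomplete⇒acyclic : Acyclic
      dcomplete⇒acyclic C =
        cycle-has-no-least-top C t t-max (proj₁ (minimal-index t)) (proj₂ (minimal-index t))
        where
        open Cycle C

        t : Fin (3 + n) → Carrier
        t i = proj₁ (top (vertex i))

        t-max : ∀ i → MaximalOfColor (vertex i) (t i)
        t-max i = proj₂ (top (vertex i))

      dcomplete⇒heap : IsDominantMinusculeHeap P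
      dcomplete⇒heap = record
        { finite          = P-finite
        ; S1-neighbors    = λ x y → inj₂ ∘ NA x y
        ; S1-incomparable = dcomplete⇒S1
        ; S2              = dcomplete⇒S2
        ; S3              = dcomplete⇒S3
        ; S4              = dcomplete⇒acyclic
        }

    -- From dominant minuscule heap to d-complete.

    module _ (heap : IsDominantMinusculeHeap P) where
      open IsDominantMinusculeHeap heap

      heap⇒EC : ∀ x y → κ x ≡ κ y → Comparable x y
      heap⇒EC x y κx≡κy with comparable? x y
      ... | yes xy = xy
      ... | no  x∥y = contradiction κx≡κy (proj₁ (S1-incomparable x y x∥y))

      heap⇒AC : ∀ x y → κ x ∼ κ y → Comparable x y
      heap⇒AC x y (_ , θ<0) with comparable? x y
      ... | yes xy = xy
      ... | no  x∥y = ⊥-elim (ℤ.<-irrefl (proj₂ (S1-incomparable x y x∥y)) θ<0)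

      -- A covering pair of equal colour would be consecutive with an empty open interval, while
      -- both alternatives of S2 exhibit an element inside.
      cover⇒κ≢ : ∀ {x y} → x ⋖ y → κ x ≢ κ y
      cover⇒κ≢ {x} {y} (x⊏y , empty) κx≡κy
        with S2 (κ x) x y (x⊏y , refl , sym κx≡κy , λ z z∈ → contradiction (z , z∈) empty)
      ... | inj₁ (u , _ , _ , only , _) = empty (u , proj₁ (from (only u) (inj₁ refl)))
      ... | inj₂ (u , only , _)         = empty (u , from (only u) refl)

      heap⇒NA : ∀ x y → Neighbors x y → κ x ∼ κ y
      heap⇒NA x y xy with S1-neighbors x y xy
      ... | inj₂ κx∼κy = κx∼κy
      ... | inj₁ κx≡κy = contradiction κx≡κy
              ([ cover⇒κ≢ , (λ y⋖x → cover⇒κ≢ y⋖x ∘ sym) ]′ xy)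

      -- In alternative (i) every element other than u and v has weight 0, leaving 1 + 1; in
      -- alternative (ii) u is the only summand and has weight 2.
      heap⇒ICE2 : ∀ a x y → Consecutive a x y →
        sumOver (openInterval-finite x y) (λ z → - θ (κ z) a) ≡ pos 2
      heap⇒ICE2 a x y cons@(_ , _ , _ , gap) =
        trans (interval-sum cons) (cong pos (weights (S2 a x y cons)))
        where
        open Finite (openInterval-finite x y)
        weights : _ → Σf (λ z → weight Γ (κ z) a) elements ≡ 2
        weights (inj₁ (u , v , u≢v , only , adj-u , adj-v)) = trans
          (sum-pair _ unique u≢v
            (from (enumerates u) (proj₁ (from (only u) (inj₁ refl))))
            (from (enumerates v) (proj₁ (from (only v) (inj₂ refl))))
            λ {z} z∈ z≢u z≢v → ≁⇒weight≡0 Γ (gap z (to (enumerates z) z∈)) λ κz∼a →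
              [ z≢u , z≢v ]′ (to (only z) (to (enumerates z) z∈ , κz∼a)))
          (cong₂ _+_ (Adjacent⇒weight Γ adj-u) (Adjacent⇒weight Γ adj-v))
        weights (inj₂ (u , only , adj-u)) = trans
          (sum-singleton _ unique (from (enumerates u) (from (only u) refl))
            λ {z} z∈ z≢u → contradiction (to (only z) (to (enumerates z) z∈)) z≢u)
          (Adjacent⇒weight Γ adj-u)

      Top : Carrier → Set _
      Top x = MaximalOfColor (κ x) x

      cover-of-top : ∀ {x y} → Top x → x ⋖ y → Top y × weight Γ (κ y) (κ x) ≡ 1
      cover-of-top {x} {y} x-max x⋖y with proj₂ (S3 (κ x) x x-max) y x⋖y
      ... | _ , adj , y-max@(refl , _) = y-max , Adjacent⇒weight Γ adj

      -- A saturated chain with n covers, hence n + 1 elements, indexed so that its colours can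
      -- serve directly as the vertices of a `Cycle`.
      record TopChain (x z : Carrier) (n : ℕ) : Set (g ⊔ p ⊔ ℓ) where
        field
          element  : Fin (suc n) → Carrier
          first    : element zero ≡ x
          last     : element (fromℕ n) ≡ z
          covers   : ∀ (i : Fin n) → element (inject₁ i) ⋖ element (suc i)
          above    : ∀ i → x ⊑ element i
          distinct : Injective _≡_ _≡_ (κ ∘ element)

      -- All elements of the old chain lie strictly above x, which is maximal in its colour, so the
      -- colour of x does not occur among theirs.
      extend : ∀ {x y z n} → Top x → x ⋖ y → TopChain y z n → TopChain x z (suc n)
      extend {x} {y} {z} {n} (_ , x-max) x⋖y chain = record
        { element  = x V.∷ element
        ; first    = refl
        ; last     = last
        ; covers   = λ { zero → subst (x ⋖_) (sym first) x⋖y ; (suc i) → covers i }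
        ; above    = λ { zero → PO.refl ; (suc i) → proj₁ (x⊏ i) }
        ; distinct = κ-injective
        }
        where
        open TopChain chain

        x⊏ : ∀ i → x ⊏ element i
        x⊏ i = ⊏-⊑-trans (proj₁ x⋖y) (above i)

        κ-injective : Injective _≡_ _≡_ (κ ∘ (x V.∷ element))
        κ-injective {zero}  {zero}  _  = refl
        κ-injective {zero}  {suc j} eq = contradiction (x⊏ j) (x-max _ (sym eq))
        κ-injective {suc i} {zero}  eq = contradiction (x⊏ i) (x-max _ eq)
        κ-injective {suc i} {suc j} eq = cong suc (distinct eq)

      -- Climb from x through covers below z; each cover is again a top by `cover-of-top`, and
      -- finiteness stops the climb.
      top-chain : ∀ {x z} → Top x → x ⊑ z → ∃ (TopChain x z)
      top-chain {x} = go (finite⇒noetherian P-finite ⊏-isStrictPartialOrder x)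
        where
        go : ∀ {x z} → Acc (flip _⊏_) x → Top x → x ⊑ z → ∃ (TopChain x z)
        go {x} {z} (acc rec) x-max x⊑z with x ≟ z
        ... | yes x≡z = 0 , record
                { element  = λ _ → x
                ; first    = refl
                ; last     = x≡z
                ; covers   = λ ()
                ; above    = λ _ → PO.refl
                ; distinct = λ { {zero} {zero} _ → refl }
                }
        ... | no  x≢z with cover-above (x⊑z , x≢z)
        ...   | y , x⋖y , y⊑z
            with go (rec (proj₁ x⋖y)) (proj₁ (cover-of-top x-max x⋖y)) y⊑z
        ...     | n , chain = suc n , extend x-max x⋖y chain

      U⇒cover : ∀ {x z} → Top x → U x z → x ⋖ z
      U⇒cover {x} {z} x-max (x⊏z , κz∼κx) with top-chain x-max (proj₁ x⊏z)
      ... | 0 , chain = contradiction (trans (sym first) last) (proj₂ x⊏z)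
        where open TopChain chain
      ... | 1 , chain = subst₂ _⋖_ first last (covers zero)
        where open TopChain chain
      -- With n + 2 covers there are n + 3 colours, the vertex count of a `Cycle`; the adjacency of
      -- `κ z` and `κ x` is the closing edge.
      ... | suc (suc n) , chain = contradiction cycle S4
        where
        open TopChain chain
        cycle : Cycle
        cycle = record
          { vertex   = κ ∘ element
          ; distinct = distinct
          ; edge     = λ i → heap⇒NA _ _ (inj₁ (covers i))
          ; closing  = subst₂ (λ u v → κ u ∼ κ v) (sym last) (sym first) κz∼κx
          }

      heap⇒UCB1 : ∀ a x → MaximalOfColor a x →
        ∃ λ (U-finite : Finite (U x)) → sumOver U-finite (λ y → - θ (κ y) a) ≤ℤ pos 1
      heap⇒UCB1 a x x-max@(refl , _) =
        U-finite , subst (_≤ℤ pos 1) (sym (U-sum U-finite))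
                     (+≤+ (bounded elements unique λ {z} → to (enumerates z)))
        where
        U-finite : Finite (U x)
        U-finite = finite-⊆
          (λ y → (x ⊏? y) ×-dec map′ (θ<0⇒∼ Γ) proj₂ (θ (κ y) (κ x) ℤ.<? 0ℤ)) _ P-finite
        open Finite U-finite

        -- Every listed element covers x. One such element has weight 1 by S3; two would coincide by
        -- S3, against the uniqueness of the listing.
        bounded : ∀ ys → Unique ys → (∀ {y} → y ∈ ys → U x y) →
                  Σf (λ y → weight Γ (κ y) (κ x)) ys ≤ 1
        bounded []           _  _   = z≤n
        bounded (y ∷ [])     _  ⊆U =
          ℕ.≤-reflexive (trans (ℕ.+-identityʳ _)
            (proj₂ (cover-of-top x-max (U⇒cover x-max (⊆U (here refl))))))
        bounded (y ∷ z ∷ _) ((y≢z ∷ _) ∷ _) ⊆U = contradiction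
          (proj₁ (S3 (κ x) x x-max) y z (U⇒cover x-max (⊆U (here refl)))
                                        (U⇒cover x-max (⊆U (there (here refl)))))
          y≢z

      heap⇒dcomplete : IsDComplete P
      heap⇒dcomplete = record
        { EC   = heap⇒EC
        ; NA   = heap⇒NA
        ; AC   = heap⇒AC
        ; ICE2 = heap⇒ICE2
        ; UCB1 = heap⇒UCB1
        }

theorem3p5 : ∀ {g p ℓ} {Γ : DynkinDiagram g} (P : ColoredPoset Γ p ℓ) →
    FinitePoset P → IsDComplete P ⇔ IsDominantMinusculeHeap P
theorem3p5 P P-finite = mk⇔ (dcomplete⇒heap P P-finite) (heap⇒dcomplete P P-finite)
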